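{- Let $X$ be a finite set with $|X|>1$. Then the free monoid $\mathbb{M}_X$ with basis $X$ is quasi-finitely axiomatizable (QFA) and prime. Moreover, if $\Gamma$ is a finite graph such that the free partially commutative monoid $A_\Gamma$ is non-trivial and has trivial center, then $A_\Gamma$ is QFA and prime.
   Context: For a finite graph $\Gamma$ with vertices $V$ and edges $E$, the free partially commutative monoid $A_\Gamma$ is the monoid with generators $V$ and relations $v_1v_2=v_2v_1$ for each edge $(v_1,v_2)\in E$. Fix a finite signature (here the signature of monoids). An infinite finitely generated structure $G$ is quasi-finitely axiomatizable (QFA) if there is a first-order sentence $\phi$ such that $G\models\phi$ and every finitely generated structure $H$ in the same signature with $H\models\phi$ is isomorphic to $G$. A structure $G$ is prime if $G$ is isomorphic to an elementary submodel of each structure $H$ elementarily equivalent to $G$. -}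

module Defs where

open import Level using (Level; _⊔_; Lift; Setω) renaming (suc to lsuc)
open import Algebra.Bundles using (Monoid; RawMonoid)
open import Algebra.Structures using (IsMagma)
open import Algebra.Morphism.Structures using (module MonoidMorphisms)
open import Data.Empty.Polymorphic using (⊥)
open import Data.Fin.Base using (Fin)
open import Data.List.Base using (List; []; _∷_; _++_)
open import Data.List.Properties using (++-assoc; ++-identityʳ)
open import Data.List.Relation.Unary.Any using (Any)
open import Data.Nat.Base using (ℕ; suc)
open import Data.Product.Base using (Σ; ∃; _×_; _,_; proj₁)
open import Data.Sum.Base using (_⊎_)
open import Data.Vec.Base using (Vec; []; _∷_; lookup; map)
open import Function.Bundles using (_↔_; _⇔_)
open import Function.Base using (_on_)
open import Relation.Binary.Core using (Rel)
open import Relation.Binary.Definitions using (Decidable; Irreflexive; Symmetric)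
open import Relation.Binary.PropositionalEquality using (_≡_; refl)
open import Relation.Nullary.Negation using (¬_)
open import Relation.Unary using (Pred)

-- The types of Agda structures of all levels do not fit in one Set, so
-- properties quantifying over all structures live in Setω.
infixr 2 _×ω_
record _×ω_ (A B : Setω) : Setω where
  constructor _,ω_
  field
    fst : A
    snd : B

-- Structures in the signature (∙ , ε) of monoids.  No monoid law is assumed:
-- IsMagma only says that _≈_, which interprets equality, is an equivalence
-- relation respected by _∙_.
record Structure c ℓ : Set (lsuc (c ⊔ ℓ)) where
  field
    rawMonoid : RawMonoid c ℓ
  open RawMonoid rawMonoid public using (Carrier; _≈_; _∙_; ε)
  field
    isMagma : IsMagma _≈_ _∙_

fromMonoid : ∀ {c ℓ} → Monoid c ℓ → Structure c ℓ
fromMonoid M = record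
  { rawMonoid = Monoid.rawMonoid M
  ; isMagma   = Monoid.isMagma M
  }

-- First-order logic in this signature.  Variables are de Bruijn indices.

infixl 8 _∙′_
infix  7 _≐_
infixr 6 _∧′_
infixr 5 _∨′_
infixr 4 _⇒′_

data Term (n : ℕ) : Set where
  var  : Fin n → Term n
  ε′   : Term n
  _∙′_ : Term n → Term n → Term n

data Formula (n : ℕ) : Set where
  _≐_            : Term n → Term n → Formula n
  ⊥′             : Formula n
  _∧′_ _∨′_ _⇒′_ : Formula n → Formula n → Formula n
  ∀′ ∃′          : Formula (suc n) → Formula n

Sentence : Set
Sentence = Formula 0

module _ {c ℓ} (G : Structure c ℓ) where
  open Structure G

  ⟦_⟧ : ∀ {n} → Term n → Vec Carrier n → Carrier
  ⟦ var i ⟧  ρ = lookup ρ i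
  ⟦ ε′ ⟧     ρ = ε
  ⟦ s ∙′ t ⟧ ρ = ⟦ s ⟧ ρ ∙ ⟦ t ⟧ ρ

  -- Tarskian satisfaction in the ambient constructive logic; assuming excluded
  -- middle in the ambient theory it is the usual classical satisfaction.
  infix 3 _⊨_[_]
  _⊨_[_] : ∀ {n} → Formula n → Vec Carrier n → Set (c ⊔ ℓ)
  _⊨_[_] (s ≐ t)  ρ = Lift c (⟦ s ⟧ ρ ≈ ⟦ t ⟧ ρ)
  _⊨_[_] ⊥′       ρ = ⊥
  _⊨_[_] (φ ∧′ ψ) ρ = _⊨_[_] φ ρ × _⊨_[_] ψ ρ
  _⊨_[_] (φ ∨′ ψ) ρ = _⊨_[_] φ ρ ⊎ _⊨_[_] ψ ρ
  _⊨_[_] (φ ⇒′ ψ) ρ = _⊨_[_] φ ρ → _⊨_[_] ψ ρ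
  _⊨_[_] (∀′ φ)   ρ = (x : Carrier) → _⊨_[_] φ (x ∷ ρ)
  _⊨_[_] (∃′ φ)   ρ = Σ Carrier λ x → _⊨_[_] φ (x ∷ ρ)

  infix 3 _⊨_
  _⊨_ : Sentence → Set (c ⊔ ℓ)
  _⊨_ φ = _⊨_[_] φ []

  FinitelyGenerated : Set (c ⊔ ℓ)
  FinitelyGenerated =
    ∃ λ n → Σ (Vec Carrier n) λ gs → ∀ x → ∃ λ (t : Term n) → ⟦ t ⟧ gs ≈ x

  Finite : Set (c ⊔ ℓ)
  Finite = Σ (List Carrier) λ xs → ∀ x → Any (x ≈_) xs

  Infinite : Set (c ⊔ ℓ)
  Infinite = ¬ Finite

module _ {c₁ ℓ₁ c₂ ℓ₂} (G : Structure c₁ ℓ₁) (H : Structure c₂ ℓ₂) where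
  private
    module G = Structure G
    module H = Structure H
  open MonoidMorphisms G.rawMonoid H.rawMonoid using (IsMonoidIsomorphism)

  Isomorphic : Set (c₁ ⊔ ℓ₁ ⊔ c₂ ⊔ ℓ₂)
  Isomorphic = Σ (G.Carrier → H.Carrier) IsMonoidIsomorphism

  ElementarilyEquivalent : Set (c₁ ⊔ ℓ₁ ⊔ c₂ ⊔ ℓ₂)
  ElementarilyEquivalent = (φ : Sentence) → (G ⊨ φ) ⇔ (H ⊨ φ)

record Substructure {c ℓ} (H : Structure c ℓ) p : Set (c ⊔ ℓ ⊔ lsuc p) where
  open Structure H
  field
    P        : Pred Carrier p
    P-resp-≈ : ∀ {x y} → x ≈ y → P x → P y
    P-ε      : P ε
    P-∙      : ∀ {x y} → P x → P y → P (x ∙ y)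

  structure : Structure (c ⊔ p) ℓ
  structure = record
    { rawMonoid = record
      { Carrier = Σ Carrier P
      ; _≈_     = _≈_ on proj₁
      ; _∙_     = λ (x , px) (y , py) → x ∙ y , P-∙ px py
      ; ε       = ε , P-ε
      }
    ; isMagma = record
      { isEquivalence = record { refl = M.refl ; sym = M.sym ; trans = M.trans }
      ; ∙-cong        = M.∙-cong
      }
    }
    where module M = IsMagma isMagma

  IsElementary : Set (c ⊔ ℓ ⊔ p)
  IsElementary = ∀ {n} (φ : Formula n) (ρ : Vec (Σ Carrier P) n) →
    (structure ⊨ φ [ ρ ]) ⇔ (H ⊨ φ [ map proj₁ ρ ])

record IsQFA {c ℓ} (G : Structure c ℓ) : Setω where
  field
    infinite          : Infinite G
    finitelyGenerated : FinitelyGenerated G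
    axiom             : Sentence
    satisfied         : G ⊨ axiom
    categorical       : ∀ {c′ ℓ′} (H : Structure c′ ℓ′) →
                        FinitelyGenerated H → H ⊨ axiom → Isomorphic H G

-- The level c ⊔ ℓ′ is that of the image { y ∣ ∃ x, f x ≈ y } of a map f : G → H.
IsPrime : ∀ {c ℓ} → Structure c ℓ → Setω
IsPrime {c} {ℓ} G = ∀ {c′ ℓ′} (H : Structure c′ ℓ′) → ElementarilyEquivalent H G →
  Σ (Substructure H (c ⊔ ℓ′)) λ K →
    Substructure.IsElementary K × Isomorphic G (Substructure.structure K)

module _ {c ℓ} (M : Monoid c ℓ) where
  open Monoid M

  Trivial : Set (c ⊔ ℓ)
  Trivial = ∀ x → x ≈ ε

  Central : Pred Carrier (c ⊔ ℓ)
  Central z = ∀ x → z ∙ x ≈ x ∙ z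

  TrivialCenter : Set (c ⊔ ℓ)
  TrivialCenter = ∀ z → Central z → z ≈ ε

-- Adjacency is decidable, as it is classically for every finite graph.
record FiniteGraph v e : Set (lsuc (v ⊔ e)) where
  infix 4 _~_
  field
    Vertex       : Set v
    order        : ℕ
    enumeration  : Vertex ↔ Fin order
    _~_          : Rel Vertex e
    ~-sym        : Symmetric _~_
    ~-irrefl     : Irreflexive _≡_ _~_
    _~?_         : Decidable _~_

module _ {v e} (Γ : FiniteGraph v e) where
  open FiniteGraph Γ

  -- The least congruence on the free monoid List Vertex making adjacent
  -- vertices commute.
  infix 4 _≈ₜ_
  data _≈ₜ_ : Rel (List Vertex) (v ⊔ e) where
    commute : ∀ {x y} → x ~ y → x ∷ y ∷ [] ≈ₜ y ∷ x ∷ []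
    reflₜ   : ∀ {xs} → xs ≈ₜ xs
    symₜ    : ∀ {xs ys} → xs ≈ₜ ys → ys ≈ₜ xs
    transₜ  : ∀ {xs ys zs} → xs ≈ₜ ys → ys ≈ₜ zs → xs ≈ₜ zs
    ++-cong : ∀ {xs xs′ ys ys′} → xs ≈ₜ xs′ → ys ≈ₜ ys′ → xs ++ ys ≈ₜ xs′ ++ ys′

  ≡⇒≈ₜ : ∀ {xs ys} → xs ≡ ys → xs ≈ₜ ys
  ≡⇒≈ₜ refl = reflₜ

  freePartiallyCommutativeMonoid : Monoid v (v ⊔ e)
  freePartiallyCommutativeMonoid = record
    { Carrier  = List Vertex
    ; _≈_      = _≈ₜ_
    ; _∙_      = _++_
    ; ε        = []
    ; isMonoid = record
      { isSemigroup = record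
        { isMagma = record
          { isEquivalence = record { refl = reflₜ ; sym = symₜ ; trans = transₜ }
          ; ∙-cong        = ++-cong
          }
        ; assoc = λ xs ys zs → ≡⇒≈ₜ (++-assoc xs ys zs)
        }
      ; identity = (λ _ → reflₜ) , (λ xs → ≡⇒≈ₜ (++-identityʳ xs))
      }
    }

{-# OPTIONS --safe #-}

-- Call elements a_v of a structure, indexed by the vertices of Γ, a basis if
-- the monoid laws hold, adjacent a_v commute, every x ≠ 1 is some a_v y,
-- a_v x ≠ 1, a_u x = a_v y only if u = v and x = y, or u ~ v and x = a_v z,
-- y = a_u z for some z, and x ≠ a_v p x q always.  This is a first-order
-- condition on the tuple a.  In a finitely generated structure a basis
-- generates: if g ≠ 1 is one of the generators then g = a_v y, and y cannot
-- involve g by the last condition, so g can be discarded.  Words in a basis are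
-- equal only if they are equal in A_Γ, so "there is a basis" axiomatizes A_Γ
-- among finitely generated structures.  Applied to A_Γ itself, this shows that
-- automorphisms act transitively on bases; hence a formula true of one basis of
-- A_Γ is true of every basis, in A_Γ and in any H ≡ A_Γ, and the submonoid
-- generated by a basis of H is elementary.
module Submission where

open import Defs
open import Algebra.Morphism.Structures using (module MonoidMorphisms)
open import Algebra.Structures using (IsMagma)
open import Data.Empty using (⊥; ⊥-elim)
open import Data.Fin.Base using (Fin; zero; suc; _↑ʳ_)
import Data.Fin.Properties as Fin
open import Data.List.Base using (List; []; _∷_; _++_; length; replicate)
open import Data.List.Extrema.Nat using (argmax; v≤f[argmax]⁺)
open import Data.List.Properties
  using (++-monoid; ++-assoc; ++-identityʳ; length-++; length-replicate)
open import Data.List.Relation.Unary.All using (All; []; _∷_)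
open import Data.List.Relation.Unary.All.Properties using (++⁺; ++⁻ˡ; ++⁻ʳ)
open import Data.List.Relation.Unary.Any as Any using (Any)
open import Data.Nat.Base using (ℕ; zero; suc; _+_; _≤_; _<_; s≤s)
open import Data.Nat.Properties
  using (≤-reflexive; ≤-trans; m≤m+n; m≤n+m; <-irrefl; 1+n≢0)
open import Data.Product.Base using (∃; _×_; _,_; proj₁; proj₂)
open import Data.Product.Function.NonDependent.Propositional using (_×-⇔_)
open import Data.Sum.Base using (_⊎_; inj₁; inj₂)
open import Data.Sum.Function.Propositional using (_⊎-⇔_)
open import Data.Vec.Base using (Vec; []; _∷_; lookup; map; tabulate)
open import Data.Vec.Properties using (lookup-map; lookup∘tabulate)
open import Function.Base using (_∘_)
open import Function.Bundles using (_↔_; _⇔_; mk⇔; Inverse; Equivalence)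
open import Function.Properties.Equivalence
  using () renaming (trans to ⇔-trans; sym to ⇔-sym)
open import Function.Properties.Inverse using (↔⇒↣)
open import Function.Related.TypeIsomorphisms using (→-cong-⇔)
open import Level using (0ℓ; _⊔_; lift; lower)
open import Relation.Binary.Definitions using (DecidableEquality)
import Relation.Binary.Reasoning.Setoid as SetoidReasoning
open import Relation.Binary.PropositionalEquality
  using (_≡_; refl; sym; trans; cong; cong₂; subst)
open import Relation.Nullary.Decidable using (Dec; yes; no; via-injection)
open import Relation.Nullary.Negation using (¬_)

open Equivalence using (to; from)

-- Satisfaction of first-order formulas

infix 9 _[_]ₜ _[_]ᶠ

weaken : ∀ {n} → Term n → Term (suc n)
weaken (var i)  = var (suc i)
weaken ε′       = ε′
weaken (s ∙′ t) = weaken s ∙′ weaken t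

lift-subst : ∀ {m n} → (Fin m → Term n) → Fin (suc m) → Term (suc n)
lift-subst σ zero    = var zero
lift-subst σ (suc i) = weaken (σ i)

_[_]ₜ : ∀ {m n} → Term m → (Fin m → Term n) → Term n
var i    [ σ ]ₜ = σ i
ε′       [ σ ]ₜ = ε′
(s ∙′ t) [ σ ]ₜ = s [ σ ]ₜ ∙′ t [ σ ]ₜ

_[_]ᶠ : ∀ {m n} → Formula m → (Fin m → Term n) → Formula n
(s ≐ t)  [ σ ]ᶠ = s [ σ ]ₜ ≐ t [ σ ]ₜ
⊥′       [ σ ]ᶠ = ⊥′
(φ ∧′ ψ) [ σ ]ᶠ = φ [ σ ]ᶠ ∧′ ψ [ σ ]ᶠ
(φ ∨′ ψ) [ σ ]ᶠ = φ [ σ ]ᶠ ∨′ ψ [ σ ]ᶠ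
(φ ⇒′ ψ) [ σ ]ᶠ = φ [ σ ]ᶠ ⇒′ ψ [ σ ]ᶠ
∀′ φ     [ σ ]ᶠ = ∀′ (φ [ lift-subst σ ]ᶠ)
∃′ φ     [ σ ]ᶠ = ∃′ (φ [ lift-subst σ ]ᶠ)

∀* ∃* : ∀ {n} → Formula n → Sentence
∀* {zero}  φ = φ
∀* {suc n} φ = ∀* (∀′ φ)
∃* {zero}  φ = φ
∃* {suc n} φ = ∃* (∃′ φ)

⋀ ⋁ : ∀ {m n} → (Fin m → Formula n) → Formula n
⋀ {zero}  φ = ⊥′ ⇒′ ⊥′
⋀ {suc m} φ = φ zero ∧′ ⋀ (φ ∘ suc)
⋁ {zero}  φ = ⊥′
⋁ {suc m} φ = φ zero ∨′ ⋁ (φ ∘ suc)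

-- Conditions on vertices such as `u ~ w` cannot be expressed in the signature, so they are decided
-- while the formula is being built: `assume` treats them as a premise, `assert` as a conjunct.
assume assert : ∀ {p n} {P : Set p} → Dec P → Formula n → Formula n
assume (yes _) φ = φ
assume (no  _) φ = ⊥′ ⇒′ ⊥′
assert (yes _) φ = φ
assert (no  _) φ = ⊥′

module _ {c ℓ} (H : Structure c ℓ) where
  open Structure H
  private module M = IsMagma isMagma

  ⟦weaken⟧ : ∀ {n} (t : Term n) {x} {ρ : Vec Carrier n} →
             ⟦_⟧ H (weaken t) (x ∷ ρ) ≡ ⟦_⟧ H t ρ
  ⟦weaken⟧ (var i)  = refl
  ⟦weaken⟧ ε′       = refl
  ⟦weaken⟧ (s ∙′ t) {x} {ρ}
    rewrite ⟦weaken⟧ s {x} {ρ} | ⟦weaken⟧ t {x} {ρ} = refl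

  -- Stated with `≈` rather than `≡`, because the word chosen for an element of a generated
  -- structure evaluates to it only up to `≈`.
  SubstEnv : ∀ {m n} → (Fin m → Term n) → Vec Carrier n → Vec Carrier m → Set ℓ
  SubstEnv σ ρ ρ′ = ∀ i → ⟦_⟧ H (σ i) ρ ≈ lookup ρ′ i

  extend-substEnv : ∀ {m n} {σ : Fin m → Term n} {ρ ρ′} → SubstEnv σ ρ ρ′ →
                    ∀ x → SubstEnv (lift-subst σ) (x ∷ ρ) (x ∷ ρ′)
  extend-substEnv         e x zero    = M.refl
  extend-substEnv {σ = σ} e x (suc i) =
    M.trans (M.reflexive (⟦weaken⟧ (σ i))) (e i)

  ⟦subst⟧ : ∀ {m n} {σ : Fin m → Term n} {ρ ρ′} → SubstEnv σ ρ ρ′ →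
            ∀ t → ⟦_⟧ H (t [ σ ]ₜ) ρ ≈ ⟦_⟧ H t ρ′
  ⟦subst⟧ e (var i)  = e i
  ⟦subst⟧ e ε′       = M.refl
  ⟦subst⟧ e (s ∙′ t) = M.∙-cong (⟦subst⟧ e s) (⟦subst⟧ e t)

  ⊨-subst : ∀ {m n} {σ : Fin m → Term n} {ρ ρ′} → SubstEnv σ ρ ρ′ →
            ∀ φ → (H ⊨ φ [ σ ]ᶠ [ ρ ]) ⇔ (H ⊨ φ [ ρ′ ])
  ⊨-subst e (s ≐ t)  = mk⇔
    (λ p → lift (M.trans (M.sym (⟦subst⟧ e s)) (M.trans (lower p) (⟦subst⟧ e t))))
    (λ p → lift (M.trans (⟦subst⟧ e s) (M.trans (lower p) (M.sym (⟦subst⟧ e t)))))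
  ⊨-subst e ⊥′       = mk⇔ (λ ()) (λ ())
  ⊨-subst e (φ ∧′ ψ) = ⊨-subst e φ ×-⇔ ⊨-subst e ψ
  ⊨-subst e (φ ∨′ ψ) = ⊨-subst e φ ⊎-⇔ ⊨-subst e ψ
  ⊨-subst e (φ ⇒′ ψ) = →-cong-⇔ (⊨-subst e φ) (⊨-subst e ψ)
  ⊨-subst e (∀′ φ)   = mk⇔
    (λ p x → to   (⊨-subst (extend-substEnv e x) φ) (p x))
    (λ p x → from (⊨-subst (extend-substEnv e x) φ) (p x))
  ⊨-subst e (∃′ φ)   = mk⇔
    (λ (x , p) → x , to   (⊨-subst (extend-substEnv e x) φ) p)
    (λ (x , p) → x , from (⊨-subst (extend-substEnv e x) φ) p)

  ⊨∀* : ∀ {n} (φ : Formula n) → (H ⊨ ∀* φ) ⇔ (∀ ρ → H ⊨ φ [ ρ ])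
  ⊨∀* {zero}  φ = mk⇔ (λ { p [] → p }) (λ p → p [])
  ⊨∀* {suc n} φ = ⇔-trans (⊨∀* (∀′ φ))
    (mk⇔ (λ { p (x ∷ ρ) → p ρ x }) (λ p ρ x → p (x ∷ ρ)))

  ⊨∃* : ∀ {n} (φ : Formula n) → (H ⊨ ∃* φ) ⇔ (∃ λ ρ → H ⊨ φ [ ρ ])
  ⊨∃* {zero}  φ = mk⇔ (λ p → [] , p) (λ { ([] , p) → p })
  ⊨∃* {suc n} φ = ⇔-trans (⊨∃* (∃′ φ))
    (mk⇔ (λ (ρ , x , p) → x ∷ ρ , p) (λ { (x ∷ ρ , p) → ρ , x , p }))

  ⊨⋀ : ∀ {m n} (φ : Fin m → Formula n) {ρ} →
       (H ⊨ ⋀ φ [ ρ ]) ⇔ (∀ i → H ⊨ φ i [ ρ ])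
  ⊨⋀ {zero}  φ = mk⇔ (λ _ ()) (λ _ b → b)
  ⊨⋀ {suc m} φ = mk⇔
    (λ { (p , q) zero → p ; (p , q) (suc i) → to (⊨⋀ (φ ∘ suc)) q i })
    (λ p → p zero , from (⊨⋀ (φ ∘ suc)) (p ∘ suc))

  ⊨⋁ : ∀ {m n} (φ : Fin m → Formula n) {ρ} →
       (H ⊨ ⋁ φ [ ρ ]) ⇔ (∃ λ i → H ⊨ φ i [ ρ ])
  ⊨⋁ {zero}  φ = mk⇔ (λ ()) (λ ())
  ⊨⋁ {suc m} φ = mk⇔
    (λ { (inj₁ p) → zero , p
       ; (inj₂ q) → let i , p = to (⊨⋁ (φ ∘ suc)) q in suc i , p })
    (λ { (zero , p) → inj₁ p ; (suc i , p) → inj₂ (from (⊨⋁ (φ ∘ suc)) (i , p)) })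

  ⊨assume : ∀ {p n} {P : Set p} (P? : Dec P) (φ : Formula n) {ρ} →
            (H ⊨ assume P? φ [ ρ ]) ⇔ (P → H ⊨ φ [ ρ ])
  ⊨assume (yes p) φ = mk⇔ (λ q _ → q) (λ q → q p)
  ⊨assume (no ¬p) φ = mk⇔ (λ _ p → ⊥-elim (¬p p)) (λ _ b → b)

  ⊨assert : ∀ {p n} {P : Set p} (P? : Dec P) (φ : Formula n) {ρ} →
            (H ⊨ assert P? φ [ ρ ]) ⇔ (P × (H ⊨ φ [ ρ ]))
  ⊨assert (yes p) φ = mk⇔ (p ,_) proj₂
  ⊨assert (no ¬p) φ = mk⇔ (λ ()) (λ (p , _) → ⊥-elim (¬p p))

-- Invariance of satisfaction under isomorphism.

module _ {c₁ ℓ₁ c₂ ℓ₂} {G : Structure c₁ ℓ₁} {H : Structure c₂ ℓ₂}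
         (iso : Isomorphic G H) where
  private
    module G = Structure G
    module H = Structure H
    module M = IsMagma H.isMagma
    open MonoidMorphisms G.rawMonoid H.rawMonoid using (module IsMonoidIsomorphism)
    open IsMonoidIsomorphism (proj₂ iso)

    f : G.Carrier → H.Carrier
    f = proj₁ iso

    preimage : ∀ y → ∃ λ x → f x H.≈ y
    preimage y with surjective y
    ... | x , p = x , p (IsMagma.refl G.isMagma)

  -- A relation rather than the vector `map f ρ`: when a quantifier ranges over `H`, an arbitrary
  -- `y` enters the environment together with a preimage `x`, for which only `f x ≈ y` is known.
  ImageEnv : ∀ {n} → Vec G.Carrier n → Vec H.Carrier n → Set ℓ₂
  ImageEnv ρ ρ′ = ∀ i → f (lookup ρ i) H.≈ lookup ρ′ i

  extend-imageEnv : ∀ {n} {ρ : Vec G.Carrier n} {ρ′ x y} →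
                    f x H.≈ y → ImageEnv ρ ρ′ → ImageEnv (x ∷ ρ) (y ∷ ρ′)
  extend-imageEnv p e zero    = p
  extend-imageEnv p e (suc i) = e i

  ⟦⟧-iso : ∀ {n} {ρ : Vec G.Carrier n} {ρ′} → ImageEnv ρ ρ′ →
           ∀ t → f (⟦_⟧ G t ρ) H.≈ ⟦_⟧ H t ρ′
  ⟦⟧-iso e (var i)  = e i
  ⟦⟧-iso e ε′       = ε-homo
  ⟦⟧-iso e (s ∙′ t) = M.trans (homo _ _) (M.∙-cong (⟦⟧-iso e s) (⟦⟧-iso e t))

  ⊨-iso : ∀ {n} {ρ : Vec G.Carrier n} {ρ′} → ImageEnv ρ ρ′ →
          ∀ φ → (G ⊨ φ [ ρ ]) ⇔ (H ⊨ φ [ ρ′ ])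
  ⊨-iso e (s ≐ t)  = mk⇔
    (λ p → lift (M.trans (M.sym (⟦⟧-iso e s))
                         (M.trans (⟦⟧-cong (lower p)) (⟦⟧-iso e t))))
    (λ p → lift (injective (M.trans (⟦⟧-iso e s)
                           (M.trans (lower p) (M.sym (⟦⟧-iso e t))))))
  ⊨-iso e ⊥′       = mk⇔ (λ ()) (λ ())
  ⊨-iso e (φ ∧′ ψ) = ⊨-iso e φ ×-⇔ ⊨-iso e ψ
  ⊨-iso e (φ ∨′ ψ) = ⊨-iso e φ ⊎-⇔ ⊨-iso e ψ
  ⊨-iso e (φ ⇒′ ψ) = →-cong-⇔ (⊨-iso e φ) (⊨-iso e ψ)
  ⊨-iso e (∀′ φ)   = mk⇔
    (λ p y → let x , fx≈y = preimage y in to (⊨-iso (extend-imageEnv fx≈y e) φ) (p x))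
    (λ p x → from (⊨-iso (extend-imageEnv M.refl e) φ) (p (f x)))
  ⊨-iso e (∃′ φ)   = mk⇔
    (λ (x , p) → f x , to (⊨-iso (extend-imageEnv M.refl e) φ) p)
    (λ (y , p) → let x , fx≈y = preimage y in
                 x , from (⊨-iso (extend-imageEnv fx≈y e) φ) p)

module _ {v e} (Γ : FiniteGraph v e) where
  open FiniteGraph Γ
  private
    module Enum = Inverse enumeration
    open Enum using () renaming (to to index; from to vertex)

    vertex-index : ∀ u → vertex (index u) ≡ u
    vertex-index u = Enum.strictlyInverseʳ u

    infix 4 _≋_
    _≋_ : List Vertex → List Vertex → Set (v ⊔ e)
    _≋_ = _≈ₜ_ Γ

  _≟_ : DecidableEquality Vertex
  _≟_ = via-injection (↔⇒↣ enumeration) Fin._≟_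

  -- Combinatorics of traces

  -- Remove u xs ys: ys is xs without an occurrence of u that is preceded only by
  -- neighbours of u.
  data Remove (u : Vertex) : List Vertex → List Vertex → Set (v ⊔ e) where
    here  : ∀ {xs} → Remove u (u ∷ xs) xs
    there : ∀ {w xs ys} → u ~ w → Remove u xs ys → Remove u (w ∷ xs) (w ∷ ys)

  ∷-cong : ∀ {u xs ys} → xs ≋ ys → u ∷ xs ≋ u ∷ ys
  ∷-cong {u} = ++-cong {xs = u ∷ []} reflₜ

  swap : ∀ {u w} xs → u ~ w → u ∷ w ∷ xs ≋ w ∷ u ∷ xs
  swap xs u~w = ++-cong {ys = xs} (commute u~w) reflₜ

  Remove⇒≋ : ∀ {u xs ys} → Remove u xs ys → xs ≋ u ∷ ys
  Remove⇒≋ here          = reflₜ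
  Remove⇒≋ (there u~w r) = transₜ (∷-cong (Remove⇒≋ r)) (swap _ (~-sym u~w))

  Remove-++ˡ : ∀ {u xs ys} zs → Remove u xs ys → Remove u (xs ++ zs) (ys ++ zs)
  Remove-++ˡ zs here          = here
  Remove-++ˡ zs (there u~w r) = there u~w (Remove-++ˡ zs r)

  Remove-++ʳ : ∀ {u xs ys zs} → All (u ~_) xs → Remove u ys zs →
               Remove u (xs ++ ys) (xs ++ zs)
  Remove-++ʳ []         r = r
  Remove-++ʳ (u~x ∷ ps) r = there u~x (Remove-++ʳ ps r)

  -- An occurrence of `u` found in the right factor has been moved across all of `xs`, whence the
  -- record `All (u ~_) xs` in the second case.
  Remove-++⁻ : ∀ {u} xs {ys zs} → Remove u (xs ++ ys) zs →
               (∃ λ xs′ → Remove u xs xs′ × zs ≡ xs′ ++ ys) ⊎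
               (∃ λ ys′ → All (u ~_) xs × Remove u ys ys′ × zs ≡ xs ++ ys′)
  Remove-++⁻ []       r    = inj₂ (_ , [] , r , refl)
  Remove-++⁻ (x ∷ xs) here = inj₁ (xs , here , refl)
  Remove-++⁻ (x ∷ xs) (there u~x r) with Remove-++⁻ xs r
  ... | inj₁ (xs′ , r′ , refl)      = inj₁ (x ∷ xs′ , there u~x r′ , refl)
  ... | inj₂ (ys′ , ps , r′ , refl) = inj₂ (ys′ , u~x ∷ ps , r′ , refl)

  -- The generating relation only permutes letters. This covers the case of a product in which the
  -- removed letter comes from the right factor while the left factor is replaced by a congruent
  -- word.
  All-resp-≋ : ∀ {u xs ys} → xs ≋ ys → All (u ~_) xs ⇔ All (u ~_) ys
  All-resp-≋ (commute _) = mk⇔ (λ { (p ∷ q ∷ []) → q ∷ p ∷ [] })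
                               (λ { (p ∷ q ∷ []) → q ∷ p ∷ [] })
  All-resp-≋ reflₜ        = mk⇔ (λ p → p) (λ p → p)
  All-resp-≋ (symₜ p)     = ⇔-sym (All-resp-≋ p)
  All-resp-≋ (transₜ p q) = ⇔-trans (All-resp-≋ p) (All-resp-≋ q)
  All-resp-≋ (++-cong {xs} {xs′} p q) = mk⇔
    (λ ps → ++⁺ (to   (All-resp-≋ p) (++⁻ˡ xs  ps)) (to   (All-resp-≋ q) (++⁻ʳ xs  ps)))
    (λ ps → ++⁺ (from (All-resp-≋ p) (++⁻ˡ xs′ ps)) (from (All-resp-≋ q) (++⁻ʳ xs′ ps)))

  -- The two remainders are compared only up to `≋`, since a congruence acting on the factor that
  -- keeps all its letters survives in them.
  Simulates : List Vertex → List Vertex → Set (v ⊔ e)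
  Simulates xs ys = ∀ {u zs} → Remove u xs zs → ∃ λ zs′ → Remove u ys zs′ × zs ≋ zs′

  Remove-commute : ∀ {x y} → x ~ y → Simulates (x ∷ y ∷ []) (y ∷ x ∷ [])
  Remove-commute x~y here             = _ , there x~y here , reflₜ
  Remove-commute x~y (there u~x here) = _ , here , reflₜ
  Remove-commute x~y (there u~x (there u~y ()))

  Remove-++-cong : ∀ {xs xs′ ys ys′} → xs ≋ xs′ → ys ≋ ys′ →
                   Simulates xs xs′ → Simulates ys ys′ → Simulates (xs ++ ys) (xs′ ++ ys′)
  Remove-++-cong {xs} {xs′} {ys} {ys′} p q f g r with Remove-++⁻ xs r
  ... | inj₁ (zs , r₁ , refl) =
    let zs′ , r₂ , zs≋zs′ = f r₁ in zs′ ++ ys′ , Remove-++ˡ ys′ r₂ , ++-cong zs≋zs′ q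
  ... | inj₂ (zs , ps , r₁ , refl) =
    let zs′ , r₂ , zs≋zs′ = g r₁ in
    xs′ ++ zs′ , Remove-++ʳ (to (All-resp-≋ p) ps) r₂ , ++-cong p zs≋zs′

  -- Both directions are proved together because of symₜ.
  ≋⇒Simulates : ∀ {xs ys} → xs ≋ ys → Simulates xs ys × Simulates ys xs
  ≋⇒Simulates (commute x~y) = Remove-commute x~y , Remove-commute (~-sym x~y)
  ≋⇒Simulates reflₜ         = (λ r → _ , r , reflₜ) , (λ r → _ , r , reflₜ)
  ≋⇒Simulates (symₜ p)      = let f , g = ≋⇒Simulates p in g , f
  ≋⇒Simulates (transₜ p q)  =
    let f , f′ = ≋⇒Simulates p ; g , g′ = ≋⇒Simulates q in compose f g , compose g′ f′
    where
    compose : ∀ {xs ys zs} → Simulates xs ys → Simulates ys zs → Simulates xs zs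
    compose f g r =
      let _ , r₁ , p₁ = f r ; _ , r₂ , p₂ = g r₁ in _ , r₂ , transₜ p₁ p₂
  ≋⇒Simulates (++-cong p q) =
    let f , f′ = ≋⇒Simulates p ; g , g′ = ≋⇒Simulates q in
    Remove-++-cong p q f g , Remove-++-cong (symₜ p) (symₜ q) f′ g′

  -- Levi's lemma for traces. Removing the head `u` on the left is simulated by a removal from
  -- `w ∷ ys`, and the two cases tell whether that removal takes the head `w` or a letter further
  -- inside, which forces `u ~ w`.
  ∷-≋-∷⁻ : ∀ {u w xs ys} → u ∷ xs ≋ w ∷ ys →
           (u ≡ w × xs ≋ ys) ⊎ (u ~ w × ∃ λ zs → xs ≋ w ∷ zs × ys ≋ u ∷ zs)
  ∷-≋-∷⁻ p with proj₁ (≋⇒Simulates p) here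
  ... | _ , here        , xs≋ys = inj₁ (refl , xs≋ys)
  ... | _ , there u~w r , xs≋zs = inj₂ (u~w , _ , xs≋zs , Remove⇒≋ r)

  ≋⇒length≡ : ∀ {xs ys} → xs ≋ ys → length xs ≡ length ys
  ≋⇒length≡ (commute _)  = refl
  ≋⇒length≡ reflₜ        = refl
  ≋⇒length≡ (symₜ p)     = sym (≋⇒length≡ p)
  ≋⇒length≡ (transₜ p q) = trans (≋⇒length≡ p) (≋⇒length≡ q)
  ≋⇒length≡ (++-cong {xs} {xs′} p q) = trans (length-++ xs)
    (trans (cong₂ _+_ (≋⇒length≡ p) (≋⇒length≡ q)) (sym (length-++ xs′)))

  -- Bases

  module _ {c ℓ} (H : Structure c ℓ) where
    open Structure H

    -- Generation by `a` quantifies over words and is not among the fields. `acyclic` stands in for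
    -- it, and for a length function: it is the condition that turns finite generation into
    -- generation by `a`.
    record IsBasis (a : Vertex → Carrier) : Set (v ⊔ e ⊔ c ⊔ ℓ) where
      field
        assoc     : ∀ x y z → (x ∙ y) ∙ z ≈ x ∙ (y ∙ z)
        identityˡ : ∀ x → ε ∙ x ≈ x
        identityʳ : ∀ x → x ∙ ε ≈ x
        a-commute : ∀ {u w} → u ~ w → a u ∙ a w ≈ a w ∙ a u
        uncons    : ∀ x → x ≈ ε ⊎ ∃ λ u → ∃ λ y → x ≈ a u ∙ y
        a∙x≉ε     : ∀ {u x} → ¬ a u ∙ x ≈ ε
        levi      : ∀ {u w x y} → a u ∙ x ≈ a w ∙ y →
                    (u ≡ w × x ≈ y) ⊎ (u ~ w × ∃ λ z → x ≈ a w ∙ z × y ≈ a u ∙ z)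
        acyclic   : ∀ {u x y z} → ¬ x ≈ a u ∙ (y ∙ (x ∙ z))

    -- Formulas see a basis as a vector, and the letters read off from the tabulation of `a` agree
    -- with `a` only pointwise.
    IsBasis-resp-≗ : ∀ {a b} → (∀ u → b u ≡ a u) → IsBasis a → IsBasis b
    IsBasis-resp-≗ {a} {b} b≗a B = record
      { assoc     = assoc
      ; identityˡ = identityˡ
      ; identityʳ = identityʳ
      ; a-commute = commute′
      ; uncons    = uncons′
      ; a∙x≉ε     = b∙x≉ε
      ; levi      = levi′
      ; acyclic   = acyclic′
      }
      where
      open IsBasis B
      commute′ : ∀ {u w} → u ~ w → b u ∙ b w ≈ b w ∙ b u
      commute′ {u} {w} rewrite b≗a u | b≗a w = a-commute
      uncons′ : ∀ x → x ≈ ε ⊎ ∃ λ u → ∃ λ y → x ≈ b u ∙ y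
      uncons′ x with uncons x
      ... | inj₁ p           = inj₁ p
      ... | inj₂ (u , y , p) = inj₂ (u , y , subst (λ g → x ≈ g ∙ y) (sym (b≗a u)) p)
      b∙x≉ε : ∀ {u x} → ¬ b u ∙ x ≈ ε
      b∙x≉ε {u} rewrite b≗a u = a∙x≉ε
      levi′ : ∀ {u w x y} → b u ∙ x ≈ b w ∙ y →
              (u ≡ w × x ≈ y) ⊎ (u ~ w × ∃ λ z → x ≈ b w ∙ z × y ≈ b u ∙ z)
      levi′ {u} {w} rewrite b≗a u | b≗a w = levi
      acyclic′ : ∀ {u x y z} → ¬ x ≈ b u ∙ (y ∙ (x ∙ z))
      acyclic′ {u} rewrite b≗a u = acyclic

    eval : (Vertex → Carrier) → List Vertex → Carrier
    eval a []       = ε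
    eval a (u ∷ xs) = a u ∙ eval a xs

    Generates : (Vertex → Carrier) → Set (v ⊔ c ⊔ ℓ)
    Generates a = ∀ x → ∃ λ xs → eval a xs ≈ x

    letters : Vec Carrier order → Vertex → Carrier
    letters ρ u = lookup ρ (index u)

  -- The first-order formula defining bases.

  ⋀ᵥ ⋁ᵥ : ∀ {n} → (Vertex → Formula n) → Formula n
  ⋀ᵥ φ = ⋀ (φ ∘ vertex)
  ⋁ᵥ φ = ⋁ (φ ∘ vertex)

  -- The tuple occupies the last `order` variables; `k` counts the quantifiers in whose scope the
  -- letter is mentioned.
  letter : ∀ k → Vertex → Term (k + order)
  letter k u = var (k ↑ʳ index u)

  private
    x₀ : ∀ {n} → Term (1 + n)
    x₀ = var zero
    x₁ : ∀ {n} → Term (2 + n)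
    x₁ = var (suc zero)
    x₂ : ∀ {n} → Term (3 + n)
    x₂ = var (suc (suc zero))

  commute′ : Vertex → Vertex → Formula order
  commute′ u w = assume (u ~? w) (letter 0 u ∙′ letter 0 w ≐ letter 0 w ∙′ letter 0 u)

  uncons′ : Vertex → Formula (1 + order)
  uncons′ u = ∃′ (x₁ ≐ letter 2 u ∙′ x₀)

  a∙x≉ε′ : Vertex → Formula order
  a∙x≉ε′ u = ∀′ (letter 1 u ∙′ x₀ ≐ ε′ ⇒′ ⊥′)

  leviCases′ : Vertex → Vertex → Formula (2 + order)
  leviCases′ u w =
    assert (u ≟ w) (x₁ ≐ x₀) ∨′
    assert (u ~? w) (∃′ (x₂ ≐ letter 3 w ∙′ x₀ ∧′ x₁ ≐ letter 3 u ∙′ x₀))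

  levi′ : Vertex → Vertex → Formula order
  levi′ u w = ∀′ (∀′ (letter 2 u ∙′ x₁ ≐ letter 2 w ∙′ x₀ ⇒′ leviCases′ u w))

  acyclic′ : Vertex → Formula order
  acyclic′ u = ∀′ (∀′ (∀′ (x₂ ≐ letter 3 u ∙′ (x₁ ∙′ (x₂ ∙′ x₀)) ⇒′ ⊥′)))

  basis′ : Formula order
  basis′ =
    ∀′ (∀′ (∀′ (x₂ ∙′ x₁ ∙′ x₀ ≐ x₂ ∙′ (x₁ ∙′ x₀)))) ∧′
    ∀′ (ε′ ∙′ x₀ ≐ x₀) ∧′
    ∀′ (x₀ ∙′ ε′ ≐ x₀) ∧′
    ⋀ᵥ (λ u → ⋀ᵥ (commute′ u)) ∧′
    ∀′ (x₀ ≐ ε′ ∨′ ⋁ᵥ uncons′) ∧′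
    ⋀ᵥ a∙x≉ε′ ∧′
    ⋀ᵥ (λ u → ⋀ᵥ (levi′ u)) ∧′
    ⋀ᵥ acyclic′

  module _ {c ℓ} (H : Structure c ℓ) where
    open Structure H

    ⊨⋀ᵥ : ∀ {n} (φ : Vertex → Formula n) {ρ} →
          (H ⊨ ⋀ᵥ φ [ ρ ]) ⇔ (∀ u → H ⊨ φ u [ ρ ])
    ⊨⋀ᵥ φ {ρ} = ⇔-trans (⊨⋀ H (φ ∘ vertex)) (mk⇔
      (λ p u → subst (λ w → H ⊨ φ w [ ρ ]) (vertex-index u) (p (index u)))
      (λ p → p ∘ vertex))

    ⊨⋁ᵥ : ∀ {n} (φ : Vertex → Formula n) {ρ} →
          (H ⊨ ⋁ᵥ φ [ ρ ]) ⇔ (∃ λ u → H ⊨ φ u [ ρ ])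
    ⊨⋁ᵥ φ {ρ} = ⇔-trans (⊨⋁ H (φ ∘ vertex)) (mk⇔
      (λ (i , p) → vertex i , p)
      (λ (u , p) → index u , subst (λ w → H ⊨ φ w [ ρ ]) (sym (vertex-index u)) p))

    ⊨⋀ᵥ² : ∀ {n} (φ : Vertex → Vertex → Formula n) {ρ} →
           (H ⊨ ⋀ᵥ (λ u → ⋀ᵥ (φ u)) [ ρ ]) ⇔ (∀ u w → H ⊨ φ u w [ ρ ])
    ⊨⋀ᵥ² φ = ⇔-trans (⊨⋀ᵥ (λ u → ⋀ᵥ (φ u))) (mk⇔
      (λ p u → to   (⊨⋀ᵥ (φ u)) (p u))
      (λ p u → from (⊨⋀ᵥ (φ u)) (p u)))

    ⊨leviCases′ : ∀ {u w x y ρ} → (H ⊨ leviCases′ u w [ y ∷ x ∷ ρ ]) ⇔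
      ((u ≡ w × x ≈ y) ⊎
       (u ~ w × ∃ λ z → x ≈ letters H ρ w ∙ z × y ≈ letters H ρ u ∙ z))
    ⊨leviCases′ {u} {w} =
      ⇔-trans (⊨assert H (u ≟ w) _)
        (mk⇔ (λ (p , q) → p , lower q) (λ (p , q) → p , lift q))
      ⊎-⇔
      ⇔-trans (⊨assert H (u ~? w) _)
        (mk⇔ (λ (p , z , q , r) → p , z , lower q , lower r)
             (λ (p , z , q , r) → p , z , lift q , lift r))

    ⊨basis′ : ∀ ρ → (H ⊨ basis′ [ ρ ]) ⇔ IsBasis H (letters H ρ)
    ⊨basis′ ρ = mk⇔ sound complete
      where
      sound : H ⊨ basis′ [ ρ ] → IsBasis H (letters H ρ)
      sound (as , il , ir , cm , un , ne , lv , ac) = record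
        { assoc     = λ x y z → lower (as x y z)
        ; identityˡ = λ x → lower (il x)
        ; identityʳ = λ x → lower (ir x)
        ; a-commute = λ {u} {w} u~w →
            lower (to (⊨assume H (u ~? w) _) (to (⊨⋀ᵥ² commute′) cm u w) u~w)
        ; uncons    = uncons-sound
        ; a∙x≉ε     = λ {u} {x} p → lower (to (⊨⋀ᵥ a∙x≉ε′) ne u x (lift p))
        ; levi      = λ {u} {w} {x} {y} p →
            to ⊨leviCases′ (to (⊨⋀ᵥ² levi′) lv u w x y (lift p))
        ; acyclic   = λ {u} {x} {y} {z} p →
            lower (to (⊨⋀ᵥ acyclic′) ac u x y z (lift p))
        }
        where
        uncons-sound : ∀ x → x ≈ ε ⊎ ∃ λ u → ∃ λ y → x ≈ letters H ρ u ∙ y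
        uncons-sound x with un x
        ... | inj₁ p = inj₁ (lower p)
        ... | inj₂ q = let u , y , p = to (⊨⋁ᵥ uncons′) q in inj₂ (u , y , lower p)

      complete : IsBasis H (letters H ρ) → H ⊨ basis′ [ ρ ]
      complete B =
        (λ x y z → lift (assoc x y z)) ,
        (λ x → lift (identityˡ x)) ,
        (λ x → lift (identityʳ x)) ,
        from (⊨⋀ᵥ² commute′)
          (λ u w → from (⊨assume H (u ~? w) _) λ u~w → lift (a-commute u~w)) ,
        uncons-complete ,
        from (⊨⋀ᵥ a∙x≉ε′) (λ u x p → lift (a∙x≉ε (lower p))) ,
        from (⊨⋀ᵥ² levi′) (λ u w x y p → from ⊨leviCases′ (levi (lower p))) ,
        from (⊨⋀ᵥ acyclic′) (λ u x y z p → lift (acyclic (lower p)))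
        where
        open IsBasis B
        uncons-complete : H ⊨ ∀′ (x₀ ≐ ε′ ∨′ ⋁ᵥ uncons′) [ ρ ]
        uncons-complete x with uncons x
        ... | inj₁ p           = inj₁ (lift p)
        ... | inj₂ (u , y , p) = inj₂ (from (⊨⋁ᵥ uncons′) (u , y , lift p))

  -- Words and generators in a structure with a basis.

  module BasisProperties {c ℓ} {H : Structure c ℓ} {a : Vertex → Structure.Carrier H}
                         (B : IsBasis H a) where
    open Structure H
    open IsBasis B
    private module M = IsMagma isMagma
    open SetoidReasoning M.setoid

    eval-++ : ∀ xs ys → eval H a (xs ++ ys) ≈ eval H a xs ∙ eval H a ys
    eval-++ []       ys = M.sym (identityˡ _)
    eval-++ (u ∷ xs) ys = begin
      a u ∙ eval H a (xs ++ ys)           ≈⟨ M.∙-cong M.refl (eval-++ xs ys) ⟩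
      a u ∙ (eval H a xs ∙ eval H a ys)   ≈⟨ assoc _ _ _ ⟨
      (a u ∙ eval H a xs) ∙ eval H a ys   ∎

    eval-cong : ∀ {xs ys} → xs ≋ ys → eval H a xs ≈ eval H a ys
    eval-cong (commute {x} {y} x~y) = begin
      a x ∙ (a y ∙ ε)   ≈⟨ assoc _ _ _ ⟨
      (a x ∙ a y) ∙ ε   ≈⟨ M.∙-cong (a-commute x~y) M.refl ⟩
      (a y ∙ a x) ∙ ε   ≈⟨ assoc _ _ _ ⟩
      a y ∙ (a x ∙ ε)   ∎
    eval-cong reflₜ        = M.refl
    eval-cong (symₜ p)     = M.sym (eval-cong p)
    eval-cong (transₜ p q) = M.trans (eval-cong p) (eval-cong q)
    eval-cong (++-cong {xs} {xs′} {ys} {ys′} p q) = begin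
      eval H a (xs ++ ys)           ≈⟨ eval-++ xs ys ⟩
      eval H a xs ∙ eval H a ys     ≈⟨ M.∙-cong (eval-cong p) (eval-cong q) ⟩
      eval H a xs′ ∙ eval H a ys′   ≈⟨ eval-++ xs′ ys′ ⟨
      eval H a (xs′ ++ ys′)         ∎

    -- Iterated use of `levi` along `xs`: either the head is `u`, or it commutes with `u` and the
    -- search goes on in the tail. Thus a divisor `a u` of the value is always visible in the word.
    eval≈a∙x⇒Remove : ∀ {u x} xs → eval H a xs ≈ a u ∙ x →
                      ∃ λ ys → Remove u xs ys × eval H a ys ≈ x
    eval≈a∙x⇒Remove []       p = ⊥-elim (a∙x≉ε (M.sym p))
    eval≈a∙x⇒Remove (w ∷ xs) p with levi p
    ... | inj₁ (refl , q) = xs , here , q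
    ... | inj₂ (w~u , z , q , r) with eval≈a∙x⇒Remove xs q
    ...   | ys , rm , s =
      w ∷ ys , there (~-sym w~u) rm , M.trans (M.∙-cong M.refl s) (M.sym r)

    -- Induction on the left word. Its first letter divides the value of `ys`, hence can be removed
    -- from `ys`, and `Remove⇒≋` moves it to the front there.
    eval-injective : ∀ xs ys → eval H a xs ≈ eval H a ys → xs ≋ ys
    eval-injective []       []       p = reflₜ
    eval-injective []       (w ∷ ys) p = ⊥-elim (a∙x≉ε (M.sym p))
    eval-injective (u ∷ xs) ys       p with eval≈a∙x⇒Remove ys (M.sym p)
    ... | ys′ , rm , q =
      transₜ (∷-cong (eval-injective xs ys′ (M.sym q))) (symₜ (Remove⇒≋ rm))

    -- ⟨ gs ⟩ is the submonoid generated by the basis together with gs.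
    data ⟨_⟩ {k} (gs : Vec Carrier k) : Carrier → Set (v ⊔ c ⊔ ℓ) where
      letterᵍ : ∀ u → ⟨ gs ⟩ (a u)
      gen     : ∀ i → ⟨ gs ⟩ (lookup gs i)
      unit    : ⟨ gs ⟩ ε
      mult    : ∀ {x y} → ⟨ gs ⟩ x → ⟨ gs ⟩ y → ⟨ gs ⟩ (x ∙ y)
      resp    : ∀ {x y} → x ≈ y → ⟨ gs ⟩ x → ⟨ gs ⟩ y

    Factor : Carrier → Carrier → Set (c ⊔ ℓ)
    Factor g x = ∃ λ y → ∃ λ z → x ≈ y ∙ (g ∙ z)

    -- The alternative is read off from the derivation, which either never invokes `g` or shows a
    -- place where it does. Membership in `⟨ gs ⟩` need not be decidable.
    avoids-or-factor : ∀ {k g} {gs : Vec Carrier k} {x} →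
                       ⟨ g ∷ gs ⟩ x → ⟨ gs ⟩ x ⊎ Factor g x
    avoids-or-factor (letterᵍ u)   = inj₁ (letterᵍ u)
    avoids-or-factor {g = g} (gen zero) = inj₂ (ε , ε , (begin
      g             ≈⟨ identityʳ g ⟨
      g ∙ ε         ≈⟨ identityˡ _ ⟨
      ε ∙ (g ∙ ε)   ∎))
    avoids-or-factor (gen (suc i)) = inj₁ (gen i)
    avoids-or-factor unit          = inj₁ unit
    avoids-or-factor {g = g} (mult {x} {y} p q) with avoids-or-factor p | avoids-or-factor q
    ... | inj₁ p′ | inj₁ q′ = inj₁ (mult p′ q′)
    ... | inj₂ (s , t , r) | _ = inj₂ (s , t ∙ y , (begin
      x ∙ y               ≈⟨ M.∙-cong r M.refl ⟩
      (s ∙ (g ∙ t)) ∙ y   ≈⟨ assoc _ _ _ ⟩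
      s ∙ ((g ∙ t) ∙ y)   ≈⟨ M.∙-cong M.refl (assoc _ _ _) ⟩
      s ∙ (g ∙ (t ∙ y))   ∎))
    ... | inj₁ _ | inj₂ (s , t , r) = inj₂ (x ∙ s , t , (begin
      x ∙ y               ≈⟨ M.∙-cong M.refl r ⟩
      x ∙ (s ∙ (g ∙ t))   ≈⟨ assoc _ _ _ ⟨
      (x ∙ s) ∙ (g ∙ t)   ∎))
    avoids-or-factor (resp x≈y p) with avoids-or-factor p
    ... | inj₁ p′          = inj₁ (resp x≈y p′)
    ... | inj₂ (s , t , r) = inj₂ (s , t , M.trans (M.sym x≈y) r)

    ⟨⟩-elim : ∀ {k g} {gs : Vec Carrier k} → ⟨ gs ⟩ g → ∀ {x} → ⟨ g ∷ gs ⟩ x → ⟨ gs ⟩ x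
    ⟨⟩-elim p (letterᵍ u)   = letterᵍ u
    ⟨⟩-elim p (gen zero)    = p
    ⟨⟩-elim p (gen (suc i)) = gen i
    ⟨⟩-elim p unit          = unit
    ⟨⟩-elim p (mult q r)    = mult (⟨⟩-elim p q) (⟨⟩-elim p r)
    ⟨⟩-elim p (resp x≈y q)  = resp x≈y (⟨⟩-elim p q)

    -- If `g ≈ a u ∙ y` and `y` had `g` as a factor, then `g` would be a factor of itself with `a u`
    -- in front, against `acyclic`. So `y` avoids `g`.
    generator-redundant : ∀ {k g} {gs : Vec Carrier k} →
                          (∀ x → ⟨ g ∷ gs ⟩ x) → ⟨ gs ⟩ g
    generator-redundant {g = g} all with uncons g
    ... | inj₁ g≈ε = resp (M.sym g≈ε) unit
    ... | inj₂ (u , y , g≈ay) with avoids-or-factor (all y)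
    ...   | inj₁ p           = resp (M.sym g≈ay) (mult (letterᵍ u) p)
    ...   | inj₂ (s , t , r) = ⊥-elim (acyclic (M.trans g≈ay (M.∙-cong M.refl r)))

    ⟨[]⟩⇒word : ∀ {x} → ⟨ [] ⟩ x → ∃ λ xs → eval H a xs ≈ x
    ⟨[]⟩⇒word (letterᵍ u)  = u ∷ [] , identityʳ _
    ⟨[]⟩⇒word unit         = [] , M.refl
    ⟨[]⟩⇒word (mult p q)   =
      let xs , r = ⟨[]⟩⇒word p ; ys , s = ⟨[]⟩⇒word q in
      xs ++ ys , M.trans (eval-++ xs ys) (M.∙-cong r s)
    ⟨[]⟩⇒word (resp x≈y p) = let xs , r = ⟨[]⟩⇒word p in xs , M.trans r x≈y

    -- Discarding `g` leaves the same hypothesis for `gs`, so induction reaches the empty list,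
    -- where only the basis remains.
    generators⇒generates : ∀ {k} (gs : Vec Carrier k) → (∀ x → ⟨ gs ⟩ x) → Generates H a
    generators⇒generates []       all x = ⟨[]⟩⇒word (all x)
    generators⇒generates (g ∷ gs) all   =
      generators⇒generates gs (λ x → ⟨⟩-elim (generator-redundant all) (all x))

    finitelyGenerated⇒generates : FinitelyGenerated H → Generates H a
    finitelyGenerated⇒generates (n , gs , terms) =
      generators⇒generates gs (λ x → let t , p = terms x in resp p (term∈ t))
      where
      term∈ : ∀ t → ⟨ gs ⟩ (⟦_⟧ H t gs)
      term∈ (var i)  = gen i
      term∈ ε′       = unit
      term∈ (s ∙′ t) = mult (term∈ s) (term∈ t)

  -- Words as terms, and maps between structures with bases.

  wordTerm : List Vertex → Term order
  wordTerm []       = ε′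
  wordTerm (u ∷ xs) = var (index u) ∙′ wordTerm xs

  ⟦wordTerm⟧ : ∀ {c ℓ} (H : Structure c ℓ) ρ xs →
               ⟦_⟧ H (wordTerm xs) ρ ≡ eval H (letters H ρ) xs
  ⟦wordTerm⟧ H ρ []       = refl
  ⟦wordTerm⟧ H ρ (u ∷ xs) = cong (Structure._∙_ H _) (⟦wordTerm⟧ H ρ xs)

  generates⇒finitelyGenerated : ∀ {c ℓ} (H : Structure c ℓ) ρ →
                                Generates H (letters H ρ) → FinitelyGenerated H
  generates⇒finitelyGenerated H ρ word = order , ρ , λ x →
    let xs , p = word x in
    wordTerm xs ,
    IsMagma.trans isMagma (IsMagma.reflexive isMagma (⟦wordTerm⟧ H ρ xs)) p
    where open Structure H using (isMagma)

  module BasisMap {c₁ ℓ₁ c₂ ℓ₂} {G : Structure c₁ ℓ₁} {H : Structure c₂ ℓ₂}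
                  {a : Vertex → Structure.Carrier G} {b : Vertex → Structure.Carrier H}
                  (A : IsBasis G a) (word : Generates G a) (B : IsBasis H b) where
    private
      module G = Structure G
      module H = Structure H
      module MG = IsMagma G.isMagma
      module MH = IsMagma H.isMagma
      module PA = BasisProperties A
      module PB = BasisProperties B
    open MonoidMorphisms G.rawMonoid H.rawMonoid using (IsMonoidMonomorphism)

    map-basis : G.Carrier → H.Carrier
    map-basis x = eval H b (proj₁ (word x))

    -- The choice made by `word` is immaterial: two words with the same value in `G` are congruent
    -- by `eval-injective`, and `eval` in `H` respects congruence. The image basis `b` need not
    -- generate `H`, so the map serves for embeddings as well.
    map-basis-unique : ∀ {x} xs → eval G a xs G.≈ x → map-basis x H.≈ eval H b xs
    map-basis-unique {x} xs p =
      PB.eval-cong (PA.eval-injective (proj₁ (word x)) xs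
        (MG.trans (proj₂ (word x)) (MG.sym p)))

    map-basis-letter : ∀ u → map-basis (a u) H.≈ b u
    map-basis-letter u = MH.trans
      (map-basis-unique (u ∷ []) (IsBasis.identityʳ A _)) (IsBasis.identityʳ B _)

    map-basis-mono : IsMonoidMonomorphism map-basis
    map-basis-mono = record
      { isMonoidHomomorphism = record
        { isMagmaHomomorphism = record
          { isRelHomomorphism = record
            { cong = λ {x} {y} x≈y →
                map-basis-unique (proj₁ (word y)) (MG.trans (proj₂ (word y)) (MG.sym x≈y)) }
          ; homo = λ x y →
              let xs , p = word x ; ys , q = word y in
              MH.trans (map-basis-unique (xs ++ ys)
                         (MG.trans (PA.eval-++ xs ys) (MG.∙-cong p q)))
                       (PB.eval-++ xs ys)
          }
        ; ε-homo = map-basis-unique [] MG.refl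
        }
      ; injective = λ {x} {y} p →
          let xs , q = word x ; ys , r = word y in
          MG.trans (MG.sym q) (MG.trans (PA.eval-cong (PB.eval-injective xs ys p)) r)
      }

    -- A word in `b` is the image of the same word in `a`.
    map-basis-iso : Generates H b → Isomorphic G H
    map-basis-iso wordH = map-basis , record
      { isMonoidMonomorphism = map-basis-mono
      ; surjective = λ y → let ys , p = wordH y in
          eval G a ys , λ z≈ → MH.trans (map-basis-unique ys (MG.sym z≈)) p
      }

  -- Quasi-finite axiomatizability and primeness.

  module _ {c ℓ} (G : Structure c ℓ) (ρ : Vec (Structure.Carrier G) order)
           (A : IsBasis G (letters G ρ)) (word : Generates G (letters G ρ)) where
    private
      module G = Structure G
      module MG = IsMagma G.isMagma
      module PA = BasisProperties A

    -- Congruent words have equal length, so length is an invariant of elements, and powers of one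
    -- letter make it unbounded.
    infinite-if-nonempty : Vertex → Infinite G
    infinite-if-nonempty u (xs , complete) =
      <-irrefl refl N≤
      where
      size : G.Carrier → ℕ
      size = length ∘ proj₁ ∘ word

      size-eval : ∀ w {y} → eval G (letters G ρ) w G.≈ y → length w ≡ size y
      size-eval w {y} p =
        ≋⇒length≡ (PA.eval-injective w (proj₁ (word y))
          (MG.trans p (MG.sym (proj₂ (word y)))))

      N : ℕ
      -- One more than the largest size in the list; `G.ε` is the default that makes `argmax`
      -- meaningful for an empty list.
      N = suc (size (argmax size G.ε xs))

      N≤ : N ≤ size (argmax size G.ε xs)
      -- The power of `u` of length `N` occurs in the list by completeness, so the maximum is at
      -- least `N`.
      N≤ = v≤f[argmax]⁺ G.ε xs (inj₂ (Any.map
        (λ p → ≤-reflexive (trans (sym (length-replicate N)) (size-eval (replicate N u) p)))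
        (complete (eval G (letters G ρ) (replicate N u)))))

    isQFA : Vertex → IsQFA G
    isQFA u = record
      { infinite          = infinite-if-nonempty u
      ; finitelyGenerated = generates⇒finitelyGenerated G ρ word
      ; axiom             = ∃* basis′
      ; satisfied         = from (⊨∃* G basis′) (ρ , from (⊨basis′ G ρ) A)
      ; categorical       = λ H fg H⊨ →
          let ρH , p = to (⊨∃* H basis′) H⊨
              B      = to (⊨basis′ H ρH) p
          -- The isomorphism starts at `H`, so `H` has to be generated by its basis; this is where
          -- finite generation of `H` enters.
          in BasisMap.map-basis-iso B
               (BasisProperties.finitelyGenerated⇒generates B fg) A word
      }

    index-image : ∀ {ρ′} (f : G.Carrier → G.Carrier) →
                  (∀ u → f (letters G ρ u) G.≈ letters G ρ′ u) →
                  ∀ i → f (lookup ρ i) G.≈ lookup ρ′ i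
    index-image {ρ′} f p i = subst (λ j → f (lookup ρ j) G.≈ lookup ρ′ j)
                                   (Enum.strictlyInverseˡ i) (p (vertex i))

    -- `G` is finitely generated, so its basis `ρ′` generates too, and the map taking `ρ` to `ρ′` is
    -- an automorphism. Automorphisms preserve satisfaction.
    basis-homogeneous : ∀ {ρ′} → G ⊨ basis′ [ ρ′ ] →
                        ∀ φ → (G ⊨ φ [ ρ ]) ⇔ (G ⊨ φ [ ρ′ ])
    basis-homogeneous {ρ′} p = ⊨-iso
      (map-basis-iso (BasisProperties.finitelyGenerated⇒generates B
        (generates⇒finitelyGenerated G ρ word)))
      (index-image {ρ′} map-basis map-basis-letter)
      where
      B = to (⊨basis′ G ρ′) p
      open BasisMap A word B

    isPrime : IsPrime G
    isPrime {c′} {ℓ′} H H≡G = K , elementary , G≅K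
      where
      open Structure H
      module MH = IsMagma isMagma

      basis-in-H : ∃ λ ρH → H ⊨ basis′ [ ρH ]
      basis-in-H = to (⊨∃* H basis′)
        (from (H≡G (∃* basis′)) (from (⊨∃* G basis′) (ρ , from (⊨basis′ G ρ) A)))

      ρH = proj₁ basis-in-H
      B  = to (⊨basis′ H ρH) (proj₂ basis-in-H)
      open BasisMap A word B
      open MonoidMorphisms.IsMonoidMonomorphism map-basis-mono

      K : Substructure H (c ⊔ ℓ′)
      K = record
        { P        = λ y → ∃ λ x → map-basis x ≈ y
        ; P-resp-≈ = λ y≈z (x , p) → x , MH.trans p y≈z
        ; P-ε      = G.ε , ε-homo
        ; P-∙      = λ (x , p) (y , q) →
            x G.∙ y , MH.trans (homo x y) (MH.∙-cong p q)
        }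

      G≅K : Isomorphic G (Substructure.structure K)
      G≅K = (λ x → map-basis x , x , MH.refl) , record
        { isMonoidMonomorphism = record
          { isMonoidHomomorphism = record
            { isMagmaHomomorphism = record
              { isRelHomomorphism = record { cong = ⟦⟧-cong } ; homo = homo }
            ; ε-homo = ε-homo
            }
          ; injective = injective
          }
        ; surjective = λ (y , x , p) → x , λ z≈x → MH.trans (⟦⟧-cong z≈x) p
        }

      -- By homogeneity, `φ` at `ρ` is equivalent in `G` both to `φ` at every basis and to `φ` at
      -- some basis. The universal sentence carries truth from `G` to `H`, the existential one from
      -- `H` to `G`. Applying the first half to the negation of `φ` would give the converse only up
      -- to double negation.
      same-type : ∀ φ → (G ⊨ φ [ ρ ]) ⇔ (H ⊨ φ [ ρH ])
      same-type φ = mk⇔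
        (λ p → to (⊨∀* H (basis′ ⇒′ φ))
          (from (H≡G (∀* (basis′ ⇒′ φ)))
            (from (⊨∀* G (basis′ ⇒′ φ)) (λ ρ′ q → to (basis-homogeneous q φ) p)))
          ρH (proj₂ basis-in-H))
        (λ p →
          let ρ′ , q , r = to (⊨∃* G (basis′ ∧′ φ)) (to (H≡G (∃* (basis′ ∧′ φ)))
                (from (⊨∃* H (basis′ ∧′ φ)) (ρH , proj₂ basis-in-H , p)))
          in from (basis-homogeneous q φ) r)

      -- Parameters in `K` are words in the basis, so substituting these words leaves a statement
      -- about the basis alone. The chain passes from `K` to `G` by isomorphism, to the basis by
      -- substitution, to `H` by `same-type`, and back to the parameters.
      elementary : Substructure.IsElementary K
      elementary {n} φ κ =
        ⇔-trans (⇔-sym (⊨-iso G≅K {ρ = preimages} image φ))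
        (⇔-trans (⇔-sym (⊨-subst G {σ = σ} substG φ))
        (⇔-trans (same-type (φ [ σ ]ᶠ))
        (⊨-subst H {σ = σ} substH φ)))
        where
        pre : Fin n → G.Carrier
        pre i = proj₁ (proj₂ (lookup κ i))

        preimages : Vec G.Carrier n
        preimages = tabulate pre

        σ : Fin n → Term order
        σ i = wordTerm (proj₁ (word (pre i)))

        image : ∀ i → map-basis (lookup preimages i) ≈ proj₁ (lookup κ i)
        image i rewrite lookup∘tabulate pre i = proj₂ (proj₂ (lookup κ i))

        substG : SubstEnv G σ ρ preimages
        substG i rewrite lookup∘tabulate pre i = MG.trans
          (MG.reflexive (⟦wordTerm⟧ G ρ (proj₁ (word (pre i))))) (proj₂ (word (pre i)))

        substH : SubstEnv H σ ρH (map proj₁ κ)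
        -- Evaluating the chosen word at `ρH` is `map-basis` by definition, so the membership proof
        -- stored in `κ` closes the goal.
        substH i rewrite lookup-map i proj₁ κ = MH.trans
          (MH.reflexive (⟦wordTerm⟧ H ρH (proj₁ (word (pre i))))) (proj₂ (proj₂ (lookup κ i)))

  isQFA×isPrime : ∀ {c ℓ} (G : Structure c ℓ) (a : Vertex → Structure.Carrier G) →
                  IsBasis G a → Generates G a → Vertex → IsQFA G ×ω IsPrime G
  isQFA×isPrime G a A word u = isQFA G ρ A′ word′ u ,ω isPrime G ρ A′ word′
    where
    open Structure G
    module MG = IsMagma isMagma

    ρ : Vec Carrier order
    ρ = tabulate (a ∘ vertex)

    letters≗a : ∀ w → letters G ρ w ≡ a w
    letters≗a w = trans (lookup∘tabulate (a ∘ vertex) (index w)) (cong a (vertex-index w))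

    A′ : IsBasis G (letters G ρ)
    A′ = IsBasis-resp-≗ G letters≗a A

    eval-≗ : ∀ xs → eval G (letters G ρ) xs ≡ eval G a xs
    eval-≗ []       = refl
    eval-≗ (w ∷ xs) rewrite letters≗a w | eval-≗ xs = refl

    word′ : Generates G (letters G ρ)
    word′ x = let xs , p = word x in xs , MG.trans (MG.reflexive (eval-≗ xs)) p

  -- Trace monoids and free monoids

  traceMonoid : Structure v (v ⊔ e)
  traceMonoid = fromMonoid (freePartiallyCommutativeMonoid Γ)

  length-acyclic : ∀ {u : Vertex} xs ys zs → ¬ length xs ≡ length (u ∷ ys ++ (xs ++ zs))
  length-acyclic xs ys zs p = <-irrefl p (s≤s (≤-trans
    (≤-trans (m≤m+n _ _) (≤-reflexive (sym (length-++ xs))))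
    (≤-trans (m≤n+m _ (length ys)) (≤-reflexive (sym (length-++ ys))))))

  traceMonoid-basis : IsBasis traceMonoid (_∷ [])
  traceMonoid-basis = record
    { assoc     = λ xs ys zs → ≡⇒≈ₜ Γ (++-assoc xs ys zs)
    ; identityˡ = λ _ → reflₜ
    ; identityʳ = λ xs → ≡⇒≈ₜ Γ (++-identityʳ xs)
    ; a-commute = commute
    ; uncons    = λ { [] → inj₁ reflₜ ; (u ∷ xs) → inj₂ (u , xs , reflₜ) }
    ; a∙x≉ε     = λ p → 1+n≢0 (≋⇒length≡ p)
    ; levi      = ∷-≋-∷⁻
    ; acyclic   = λ {u} {xs} {ys} {zs} p → length-acyclic {u} xs ys zs (≋⇒length≡ p)
    }

  traceMonoid-generated : Generates traceMonoid (_∷ [])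
  traceMonoid-generated xs = xs , ≡⇒≈ₜ Γ (eval-singletons xs)
    where
    eval-singletons : ∀ xs → eval traceMonoid (_∷ []) xs ≡ xs
    eval-singletons []       = refl
    eval-singletons (u ∷ xs) = cong (u ∷_) (eval-singletons xs)

  nontrivial⇒vertex : ¬ Trivial (freePartiallyCommutativeMonoid Γ) → Vertex
  nontrivial⇒vertex nontrivial = fromFin order vertex index
    where
    -- The number of vertices is abstracted to a variable `n` so that it can be split together with
    -- the types of both maps. For `n` zero the empty word is the only word, contradicting
    -- nontriviality.
    fromFin : ∀ n → (Fin n → Vertex) → (Vertex → Fin n) → Vertex
    fromFin (suc _) f _ = f zero
    fromFin zero    _ g = ⊥-elim (nontrivial
      λ { [] → reflₜ ; (u ∷ _) → ⊥-elim (Fin.¬Fin0 (g u)) })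

module _ {x} (X : Set x) (n : ℕ) (X↔Fin : X ↔ Fin n) where

  edgeless : FiniteGraph x 0ℓ
  edgeless = record
    { Vertex      = X
    ; order       = n
    ; enumeration = X↔Fin
    ; _~_         = λ _ _ → ⊥
    ; ~-sym       = λ ()
    ; ~-irrefl    = λ _ ()
    ; _~?_        = λ _ _ → no (λ ())
    }

  -- Here equality is `≡` on lists, not `≈ₜ`, so the conditions are verified afresh. Without edges
  -- only the first alternative of `levi` arises, namely injectivity of `_∷_`.
  freeMonoid-basis : IsBasis edgeless (fromMonoid (++-monoid X)) (_∷ [])
  freeMonoid-basis = record
    { assoc     = ++-assoc
    ; identityˡ = λ _ → refl
    ; identityʳ = ++-identityʳ
    ; a-commute = λ ()
    ; uncons    = λ { [] → inj₁ refl ; (u ∷ xs) → inj₂ (u , xs , refl) }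
    ; a∙x≉ε     = λ ()
    ; levi      = λ { refl → inj₁ (refl , refl) }
    ; acyclic   = λ {u} {xs} {ys} {zs} p →
        length-acyclic edgeless {u} xs ys zs (cong length p)
    }

  freeMonoid-generated : Generates edgeless (fromMonoid (++-monoid X)) (_∷ [])
  freeMonoid-generated []       = [] , refl
  freeMonoid-generated (u ∷ xs) =
    let ys , p = freeMonoid-generated xs in u ∷ ys , cong (u ∷_) p

mainTheorem6 : (∀ {x} (X : Set x) (n : ℕ) → X ↔ Fin n → 1 < n →
    IsQFA (fromMonoid (++-monoid X)) ×ω IsPrime (fromMonoid (++-monoid X)))
    ×ω
    (∀ {v e} (Γ : FiniteGraph v e) →
    ¬ Trivial (freePartiallyCommutativeMonoid Γ) →
    TrivialCenter (freePartiallyCommutativeMonoid Γ) →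
    IsQFA (fromMonoid (freePartiallyCommutativeMonoid Γ))
    ×ω IsPrime (fromMonoid (freePartiallyCommutativeMonoid Γ)))
mainTheorem6 =
  (λ { X (suc n) X↔Fin _ → isQFA×isPrime (edgeless X (suc n) X↔Fin) _ _
         (freeMonoid-basis X (suc n) X↔Fin) (freeMonoid-generated X (suc n) X↔Fin)
         (Inverse.from X↔Fin zero) })
  ,ω
  (λ Γ nontrivial _ → isQFA×isPrime Γ _ _
         (traceMonoid-basis Γ) (traceMonoid-generated Γ) (nontrivial⇒vertex Γ nontrivial))
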